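{- Let $(S,+)$ be a commutative cancellative semigroup with no identity element such that its difference group $S-S$ carries a multiplication $\cdot$ making $(S-S,+,\cdot)$ an integral domain. Suppose $\kappa$ is an infinite regular cardinal, $|S|=\kappa$, and $((S-S)\setminus\{0\},\cdot)$ is a very weakly cancellative semigroup. Then every PP-rich set in $S$ has cardinality $\kappa$.
   Context: $S-S=\{a-b:a,b\in S\}$ is the difference group of $S$. $\mathbb{P}$ is the set of polynomial functions $S-S\to S-S$ in one variable with coefficients in $S-S$ and zero constant term; $\mathcal{P}_f(\mathbb{P})$ the set of its nonempty finite subsets. $A\subseteq S$ is PP-rich if for every $R\in\mathcal{P}_f(\mathbb{P})$ there exist $a,x\in S$ with $\{a+f(x): f\in R\}\subseteq A$. An infinite semigroup $(T,\cdot)$ of cardinality $\nu$ is very weakly cancellative if the union of fewer than $\nu$ sets of the form $\{x: a x=b\}$ has cardinality $<\nu$, and likewise for sets of the form $\{x: x a=b\}$. -}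

module Defs where

open import Level using (Level; _⊔_; suc)
open import Algebra.Bundles using (CommutativeSemigroup; Semigroup)
open import Algebra.Core using (Op₁; Op₂)
open import Algebra.Structures using (IsCommutativeRing)
open import Data.List.Base using (List; []; _∷_)
open import Data.List.NonEmpty.Base using (List⁺)
open import Data.List.NonEmpty.Relation.Unary.All using (All)
open import Data.Nat.Base using (ℕ)
open import Data.Product.Base using (Σ; ∃; ∃-syntax; _×_; _,_; proj₁; proj₂)
open import Data.Sum.Base using (_⊎_; [_,_]′)
open import Function.Bundles using (Injection; Bijection; _⟶ₛ_; _⟨$⟩_)
open import Induction.WellFounded using (WellFounded)
open import Relation.Binary.Bundles using (Setoid; StrictTotalOrder)
open import Relation.Binary.Core using (Rel)
open import Relation.Binary.Definitions using (_Respects_)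
import Relation.Binary.Construct.On as On
import Relation.Binary.PropositionalEquality.Properties as ≡
open import Relation.Nullary.Negation.Core using (¬_)
open import Relation.Unary using (Pred)

------------------------------------------------------------------------
-- Cardinality.  Sets are setoids; cardinals are compared through
-- injections and bijections of setoids.

infixl 5 _↾_
infix  4 _≼_ _≺_ _≅_

-- A subset, as a setoid: two elements are equal when they are equal in
-- the ambient setoid, whatever the proofs of membership.
_↾_ : ∀ {a r p} (X : Setoid a r) → Pred (Setoid.Carrier X) p → Setoid (a ⊔ p) r
X ↾ P = On.setoid {B = Σ (Setoid.Carrier X) P} X proj₁

_≼_ _≺_ _≅_ : ∀ {a r b s} → Setoid a r → Setoid b s → Set (a ⊔ r ⊔ b ⊔ s)
X ≼ Y = Injection X Y
X ≺ Y = X ≼ Y × ¬ (Y ≼ X)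
X ≅ Y = Bijection X Y

Infinite : ∀ {a r} → Setoid a r → Set (a ⊔ r)
Infinite X = ≡.setoid ℕ ≼ X

-- An infinite regular cardinal κ, as an initial ordinal: a well-order
-- all of whose proper initial segments have smaller cardinality, and
-- whose cofinality (the least cardinality of a cofinal subset) is κ.
record InfiniteRegularCardinal (ℓ : Level) : Set (suc ℓ) where
  field
    order : StrictTotalOrder ℓ ℓ ℓ

  open StrictTotalOrder order public using (Carrier; _≈_; _<_)

  asSet : Setoid ℓ ℓ
  asSet = StrictTotalOrder.Eq.setoid order

  Cofinal : Pred Carrier ℓ → Set ℓ
  Cofinal C = ∀ α → ∃[ β ] C β × (α < β ⊎ α ≈ β)

  field
    wellFounded : WellFounded _<_
    initial     : ∀ α → asSet ↾ (_< α) ≺ asSet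
    infinite    : Infinite asSet
    regular     : ∀ (C : Pred Carrier ℓ) → C Respects _≈_ → Cofinal C →
                  asSet ≼ asSet ↾ C

------------------------------------------------------------------------
-- Very weak cancellativity.

-- With ν = |T|, a family of fewer than ν sets of the form
-- {x : a x = b} is given by an index set I with |I| < ν and functions
-- a, b : I → T.
record IsVeryWeaklyCancellative {ℓ} (T : Semigroup ℓ ℓ) : Set (suc ℓ) where
  open Semigroup T using (Carrier; _≈_; _∙_; setoid)
  field
    infinite : Infinite setoid
    left     : ∀ (I : Setoid ℓ ℓ) → I ≺ setoid → (a b : I ⟶ₛ setoid) →
               setoid ↾ (λ x → ∃[ i ] (a ⟨$⟩ i) ∙ x ≈ (b ⟨$⟩ i)) ≺ setoid
    right    : ∀ (I : Setoid ℓ ℓ) → I ≺ setoid → (a b : I ⟶ₛ setoid) →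
               setoid ↾ (λ x → ∃[ i ] x ∙ (a ⟨$⟩ i) ≈ (b ⟨$⟩ i)) ≺ setoid

------------------------------------------------------------------------
-- Integral domains.

record IsIntegralDomain {a r} {A : Set a} (_≈_ : Rel A r)
         (_+_ _*_ : Op₂ A) (-_ : Op₁ A) (0# 1# : A) : Set (a ⊔ r) where
  field
    isCommutativeRing : IsCommutativeRing _≈_ _+_ _*_ -_ 0# 1#
    1≉0               : ¬ (1# ≈ 0#)
    noZeroDivisors    : ∀ x y → (x * y) ≈ 0# → (x ≈ 0#) ⊎ (y ≈ 0#)

  open IsCommutativeRing isCommutativeRing public

module _ {a r} {A : Set a} {_≈_ : Rel A r} {_+_ _*_ : Op₂ A}
         { -_ : Op₁ A} {0# 1# : A}
         (isID : IsIntegralDomain _≈_ _+_ _*_ -_ 0# 1#) where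

  private module D = IsIntegralDomain isID

  nonzeroSemigroup : Semigroup (a ⊔ r) r
  nonzeroSemigroup = record
    { Carrier     = Σ A (λ x → ¬ (x ≈ 0#))
    ; _≈_         = λ x y → proj₁ x ≈ proj₁ y
    ; _∙_         = λ { (x , x≉0) (y , y≉0) →
                        x * y , λ xy≈0 → [ x≉0 , y≉0 ]′ (D.noZeroDivisors x y xy≈0) }
    ; isSemigroup = record
      { isMagma = record
        { isEquivalence = On.isEquivalence proj₁ D.isEquivalence
        ; ∙-cong        = D.*-cong
        }
      ; assoc = λ x y z → D.*-assoc (proj₁ x) (proj₁ y) (proj₁ z)
      }
    }

------------------------------------------------------------------------
-- The difference group S - S.

-- The pair (a , b) stands for a - b.  When S is cancellative, _≈ᵈ_ is
-- an equivalence relation, and when moreover S is inhabited, _+ᵈ_ and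
-- -ᵈ_ make the pairs an abelian group.
module Difference {ℓ} (S : CommutativeSemigroup ℓ ℓ) where
  open CommutativeSemigroup S renaming (_∙_ to _+_)

  infix  4 _≈ᵈ_
  infixl 6 _+ᵈ_
  infix  8 -ᵈ_

  Diff : Set ℓ
  Diff = Carrier × Carrier

  _≈ᵈ_ : Rel Diff ℓ
  (a , b) ≈ᵈ (c , d) = a + d ≈ c + b

  _+ᵈ_ : Op₂ Diff
  (a , b) +ᵈ (c , d) = (a + c) , (b + d)

  -ᵈ_ : Op₁ Diff
  -ᵈ (a , b) = b , a

  -- The embedding S → S - S; as S need not have an identity, a is
  -- represented as (a + a) - a.
  ι : Carrier → Diff
  ι a = (a + a) , a

  module Polynomial (_*_ : Op₂ Diff) (0# : Diff) where

    -- c₁ z + c₂ z² + ⋯ + cₙ zⁿ, by Horner's rule.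
    eval : List Diff → Diff → Diff
    eval []       z = 0#
    eval (c ∷ cs) z = z * (c +ᵈ eval cs z)

    IsPolynomialFunction₀ : Pred (Diff → Diff) ℓ
    IsPolynomialFunction₀ f = ∃[ cs ] ∀ z → f z ≈ᵈ eval cs z

    ℙ : Set ℓ
    ℙ = ∃ IsPolynomialFunction₀

    PPRich : Pred Carrier ℓ → Set ℓ
    PPRich A = ∀ (R : List⁺ ℙ) → ∃[ a ] ∃[ x ]
      All (λ f → ∃[ b ] A b × ι b ≈ᵈ ι a +ᵈ proj₁ f (ι x)) R

{-# OPTIONS --safe #-}

-- Label the elements s of S by triples from A: the family R = {0, z, s z}
-- yields a, x with a, a + x, a + s x in A.  The triple determines x and s x,
-- hence s, because x ≠ 0 (S has no identity) and S - S has no zero divisors.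
-- If A were bounded in the ordering of S by κ, three applications of the
-- pigeonhole principle for the regular cardinal κ would give unboundedly many
-- s with the same triple.  So A is cofinal in κ, and regularity gives |A| = κ.
module Submission where

open import Algebra.Bundles using (CommutativeRing; CommutativeSemigroup)
open import Algebra.Core using (Op₁; Op₂)
open import Algebra.Definitions using (Cancellative; Identity)
open import Axiom.ExcludedMiddle using (ExcludedMiddle)
open import Data.List.Base using (List; []; _∷_)
open import Data.List.NonEmpty.Base using (_∷_)
open import Data.List.NonEmpty.Relation.Unary.All using (_∷_)
open import Data.List.Relation.Unary.All using ([]; _∷_)
open import Data.Nat.Base using (ℕ)
open import Data.Product.Base using (∃; ∃-syntax; _×_; _,_; proj₁; proj₂)
open import Data.Sum.Base using (_⊎_; inj₁; inj₂)
open import Data.Unit.Polymorphic.Base using (⊤; tt)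
open import Function.Bundles using (Injection; Bijection; Inverse)
import Function.Construct.Composition as Composition
open import Function.Properties.Bijection using (Bijection⇒Inverse)
open import Induction.WellFounded using (Acc; acc)
open import Relation.Binary.Bundles using (Setoid; StrictTotalOrder)
open import Relation.Binary.Core using (Rel)
open import Relation.Binary.Definitions using (_Respects_; tri<; tri≈; tri>)
import Relation.Binary.PropositionalEquality.Properties as ≡
import Relation.Binary.Reasoning.Setoid as SetoidReasoning
open import Relation.Nullary.Decidable.Core using (yes; no; decidable-stable)
open import Relation.Nullary.Negation.Core using (¬_; contradiction)
open import Relation.Unary using (Pred; _⊆_)
open import Defs

-- Cantor-Bernstein for setoids.

module CantorBernstein {ℓ} (em : ExcludedMiddle ℓ) {X Y : Setoid ℓ ℓ} (f : X ≼ Y) (g : Y ≼ X) where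

  private
    module X = Setoid X
    module Y = Setoid Y
    module f = Injection f
    module g = Injection g

  -- The elements whose backward orbit under g and f ends in X.
  data Chain : X.Carrier → Set ℓ where
    base : ∀ {x} → (∀ y → ¬ g.to y X.≈ x) → Chain x
    step : ∀ {x x′} → Chain x′ → g.to (f.to x′) X.≈ x → Chain x

  Chain-resp : Chain Respects X._≈_
  Chain-resp x≈x′ (base ∉im)  = base λ y gy≈x′ → ∉im y (X.trans gy≈x′ (X.sym x≈x′))
  Chain-resp x≈x′ (step c eq) = step c (X.trans eq x≈x′)

  -- The bijection follows `f` on chains and inverts `g` elsewhere. As a relation it can be analysed
  -- by cases independently of the decisions that `em` makes in `total`.
  Graph : X.Carrier → Y.Carrier → Set ℓ
  Graph x y = (Chain x × f.to x Y.≈ y) ⊎ (¬ Chain x × g.to y X.≈ x)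

  total : ∀ x → ∃ (Graph x)
  total x with em {Chain x}
  ... | yes c = f.to x , inj₁ (c , Y.refl)
  ... | no ¬c with em {∃[ y ] g.to y X.≈ x}
  ...   | yes (y , gy≈x) = y , inj₂ (¬c , gy≈x)
  -- A point outside the image of `g` starts a chain, so `g` can be inverted at every point off
  -- `Chain`.
  ...   | no ∉im = contradiction (base λ y gy≈x → ∉im (y , gy≈x)) ¬c

  functional : ∀ {x x′ y y′} → x X.≈ x′ → Graph x y → Graph x′ y′ → y Y.≈ y′
  functional x≈x′ (inj₁ (_ , p)) (inj₁ (_ , q)) = Y.trans (Y.sym p) (Y.trans (f.cong x≈x′) q)
  functional x≈x′ (inj₁ (c , _)) (inj₂ (¬c , _)) = contradiction (Chain-resp x≈x′ c) ¬c
  functional x≈x′ (inj₂ (¬c , _)) (inj₁ (c , _)) = contradiction (Chain-resp (X.sym x≈x′) c) ¬c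
  functional x≈x′ (inj₂ (_ , p)) (inj₂ (_ , q)) = g.injective (X.trans p (X.trans x≈x′ (X.sym q)))

  injective : ∀ {x x′ y y′} → Graph x y → Graph x′ y′ → y Y.≈ y′ → x X.≈ x′
  injective (inj₁ (_ , p)) (inj₁ (_ , q)) y≈y′ = f.injective (Y.trans p (Y.trans y≈y′ (Y.sym q)))
  -- Here `x′` is `g (f x)`, so it prolongs the chain of `x`, against `¬c`.
  injective (inj₁ (c , p)) (inj₂ (¬c , q)) y≈y′ =
    contradiction (step c (X.trans (g.cong (Y.trans p y≈y′)) q)) ¬c
  injective (inj₂ (¬c , q)) (inj₁ (c , p)) y≈y′ =
    contradiction (step c (X.trans (g.cong (Y.trans p (Y.sym y≈y′))) q)) ¬c
  injective (inj₂ (_ , p)) (inj₂ (_ , q)) y≈y′ = X.trans (X.sym p) (X.trans (g.cong y≈y′) q)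

  -- If `g y` is on a chain, it is not a starting point, being in the image of `g`; injectivity of
  -- `g` turns the last step into a preimage of `y` under `f`.
  surjective : ∀ y → ∃[ x ] Graph x y
  surjective y with em {Chain (g.to y)}
  ... | no ¬c                      = g.to y , inj₂ (¬c , X.refl)
  ... | yes (base ∉im)             = contradiction X.refl (∉im y)
  ... | yes (step {x′ = x} c gfx≈gy) = x , inj₁ (c , g.injective gfx≈gy)

  bijection : X ≅ Y
  bijection = record
    { to        = λ x → proj₁ (total x)
    ; cong      = λ x≈x′ → functional x≈x′ (proj₂ (total _)) (proj₂ (total _))
    ; bijective =
        (λ y≈y′ → injective (proj₂ (total _)) (proj₂ (total _)) y≈y′)
      , (λ y → let x , Hxy = surjective y in
               x , λ z≈x → functional z≈x (proj₂ (total _)) Hxy)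
    }

-- Bounded and cofinal subsets of a regular cardinal.

module RegularCardinal {ℓ} (em : ExcludedMiddle ℓ) (κ : InfiniteRegularCardinal ℓ) where
  open InfiniteRegularCardinal κ
  open StrictTotalOrder order using (compare; trans; <-respˡ-≈; <-respʳ-≈; module Eq)

  Least : Pred Carrier ℓ → Pred Carrier ℓ
  Least P μ = P μ × (∀ β → P β → ¬ β < μ)

  least : ∀ P → ∃ P → ∃ (Least P)
  least P (α , Pα) = go Pα (wellFounded α)
    where
    go : ∀ {α} → P α → Acc _<_ α → ∃ (Least P)
    go {α} Pα (acc rs) with em {∃[ β ] P β × β < α}
    ... | yes (β , Pβ , β<α) = go Pβ (rs β<α)
    ... | no  none           = α , Pα , λ β Pβ β<α → none (β , Pβ , β<α)

  -- Two coextensive predicates are allowed because the ones compared later depend on parameters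
  -- that are only `_≈_`-equal.
  Least-unique : ∀ {P Q α β} → P ⊆ Q → Q ⊆ P → Least P α → Least Q β → α ≈ β
  Least-unique {α = α} {β} P⊆Q Q⊆P (Pα , minα) (Qβ , minβ) with compare α β
  ... | tri< α<β _ _ = contradiction α<β (minβ α (P⊆Q Pα))
  ... | tri≈ _ α≈β _ = α≈β
  ... | tri> _ _ β<α = contradiction β<α (minα β (Q⊆P Qβ))

  Least-resp : ∀ {P} → P Respects _≈_ → Least P Respects _≈_
  Least-resp P-resp α≈β (Pα , min) =
    P-resp α≈β Pα , λ γ Pγ γ<β → min γ Pγ (<-respʳ-≈ (Eq.sym α≈β) γ<β)

  -- Bounds are strict, so a bounded set lies in the initial segment below its bound.
  UpperBound : Pred Carrier ℓ → Pred Carrier ℓ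
  UpperBound P δ = ∀ α → P α → α < δ

  UpperBound-resp : ∀ {P} → UpperBound P Respects _≈_
  UpperBound-resp δ≈ε ub α Pα = <-respʳ-≈ δ≈ε (ub α Pα)

  -- By trichotomy, an `α` with no element of `P` at or above it is a strict bound.
  ¬Cofinal⇒bounded : ∀ P → ¬ Cofinal P → ∃ (UpperBound P)
  ¬Cofinal⇒bounded P ¬cof with em {∃ (UpperBound P)}
  ... | yes bounded = bounded
  ... | no ¬bounded = contradiction cof ¬cof
    where
    cof : Cofinal P
    cof α with em {∃[ β ] P β × (α < β ⊎ α ≈ β)}
    ... | yes above = above
    ... | no ¬above = contradiction (α , below) ¬bounded
      where
      below : UpperBound P α
      below β Pβ with compare β α
      ... | tri< β<α _ _ = β<α
      ... | tri≈ _ β≈α _ = contradiction (β , Pβ , inj₂ (Eq.sym β≈α)) ¬above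
      ... | tri> _ _ α<β = contradiction (β , Pβ , inj₁ α<β) ¬above

  Cofinal-distinct : ∀ P → Cofinal P → ∃[ α ] ∃[ β ] P α × P β × ¬ (α ≈ β)
  Cofinal-distinct P cof =
    let γ₀ , α , Pα , α≈γ₀ = Injection.to elements 0
        γ₁ , β , Pβ , β≈γ₁ = Injection.to elements 1
    in α , β , Pα , Pβ , λ α≈β →
       contradiction (Injection.injective elements (Eq.trans (Eq.sym α≈γ₀) (Eq.trans α≈β β≈γ₁)))
                     λ ()
    where
    -- P need not respect _≈_, which regularity requires.
    closure : Pred Carrier ℓ
    closure α = ∃[ β ] P β × β ≈ α

    closure-cofinal : Cofinal closure
    closure-cofinal α = let β , Pβ , α≤β = cof α in β , (β , Pβ , Eq.refl) , α≤β

    elements : ≡.setoid ℕ ≼ asSet ↾ closure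
    elements = Composition.injection infinite
      (regular closure (λ α≈β (γ , Pγ , γ≈α) → γ , Pγ , Eq.trans γ≈α α≈β) closure-cofinal)

  -- If every fibre were bounded, the least bounds of the fibres would be cofinal
  -- in κ, yet no more numerous than the labels.
  pigeonhole : ∀ {X} → ¬ Cofinal X → ∀ {C} → Cofinal C →
               (R : Rel Carrier ℓ) → (∀ {α} → R α Respects _≈_) →
               (∀ {α} → C α → ∃[ β ] X β × R α β) →
               ∃[ β ] X β × Cofinal (λ α → C α × R α β)
  pigeonhole {X} ¬cofX {C} cofC R R-resp total
    with em {∃[ β ] X β × Cofinal (λ α → C α × R α β)}
  ... | yes found = found
  ... | no ¬found =
    let δ , X<δ = ¬Cofinal⇒bounded X ¬cofX in
    -- Regularity injects `κ` into `Sup`, hence into the segment below `δ`, which initiality makes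
    -- smaller.
    contradiction (Composition.injection (regular Sup Sup-resp Sup-cofinal) (Sup≼ δ X<δ))
                  (proj₂ (initial δ))
    where
    Fibre : Rel Carrier ℓ
    Fibre β α = C α × R α β

    LeastBound : Rel Carrier ℓ
    LeastBound β = Least (UpperBound (Fibre β))

    Sup : Pred Carrier ℓ
    Sup ε = ∃[ β ] X β × LeastBound β ε

    LeastBound-resp : ∀ {β} → LeastBound β Respects _≈_
    LeastBound-resp = Least-resp UpperBound-resp

    Sup-resp : Sup Respects _≈_
    Sup-resp ε≈ε′ (β , Xβ , lb) = β , Xβ , LeastBound-resp ε≈ε′ lb

    -- Some element of `C` at or above `γ` lies in a fibre. Since no fibre over `X` is cofinal, this
    -- one has a least strict bound, which exceeds `γ`.
    Sup-cofinal : Cofinal Sup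
    Sup-cofinal γ with cofC γ
    ... | α , Cα , γ≤α with total Cα
    ... | β , Xβ , Rαβ with least (UpperBound (Fibre β))
                              (¬Cofinal⇒bounded (Fibre β) λ cof → ¬found (β , Xβ , cof))
    ... | ε , lb = ε , (β , Xβ , lb) , inj₁ (γ<ε γ≤α)
      where
      γ<ε : γ < α ⊎ γ ≈ α → γ < ε
      γ<ε (inj₁ γ<α) = trans γ<α (proj₁ lb α (Cα , Rαβ))
      γ<ε (inj₂ γ≈α) = <-respˡ-≈ (Eq.sym γ≈α) (proj₁ lb α (Cα , Rαβ))

    Fibre-resp : ∀ {α} → (λ β → Fibre β α) Respects _≈_
    Fibre-resp β≈β′ (Cα , Rαβ) = Cα , R-resp β≈β′ Rαβ

    LeastBound-injective : ∀ {β β′ ε ε′} → β ≈ β′ →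
                           LeastBound β ε → LeastBound β′ ε′ → ε ≈ ε′
    LeastBound-injective β≈β′ = Least-unique
      (λ ub α F → ub α (Fibre-resp (Eq.sym β≈β′) F))
      (λ ub α F → ub α (Fibre-resp β≈β′ F))

    -- Each bound goes to the least label whose fibre it bounds; taking the least makes the choice
    -- independent of the membership proof. A label determines its least bound, so the map is
    -- injective.
    Sup≼ : ∀ δ → UpperBound X δ → asSet ↾ Sup ≼ asSet ↾ (_< δ)
    Sup≼ δ X<δ = record
      { to        = λ { (ε , s) → let β , (Xβ , _) , _ = label s in β , X<δ β Xβ }
      ; cong      = λ { {ε , s} {ε′ , s′} ε≈ε′ → Least-unique
          (λ (Xβ , lb) → Xβ , LeastBound-resp ε≈ε′ lb)
          (λ (Xβ , lb) → Xβ , LeastBound-resp (Eq.sym ε≈ε′) lb)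
          (proj₂ (label s)) (proj₂ (label s′)) }
      ; injective = λ { {ε , s} {ε′ , s′} β≈β′ → LeastBound-injective β≈β′
          (proj₂ (proj₁ (proj₂ (label s)))) (proj₂ (proj₁ (proj₂ (label s′)))) }
      }
      where
      label : ∀ {ε} → Sup ε → ∃ (Least (λ β → X β × LeastBound β ε))
      label {ε} = least (λ β → X β × LeastBound β ε)

  -- Inclusion and regularity give the two injections.
  Cofinal⇒≅ : ∀ {P} → P Respects _≈_ → Cofinal P → asSet ↾ P ≅ asSet
  Cofinal⇒≅ {P} P-resp cof =
    CantorBernstein.bijection em {asSet ↾ P} {asSet}
      (record { to = proj₁ ; cong = λ eq → eq ; injective = λ eq → eq })
      (regular P P-resp cof)

-- Recovering a coefficient from three values in an integral domain.

module IntegralDomain {a r} {A : Set a} {_≈_ : Rel A r} {_+_ _*_ : Op₂ A}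
                      { -_ : Op₁ A} {0# 1# : A}
                      (isID : IsIntegralDomain _≈_ _+_ _*_ -_ 0# 1#) where
  private
    module D = IsIntegralDomain isID

    R : CommutativeRing a r
    R = record { isCommutativeRing = D.isCommutativeRing }

    setoid : Setoid a r
    setoid = CommutativeRing.setoid R

  open SetoidReasoning setoid
  open import Algebra.Properties.Ring (CommutativeRing.ring R) using (x[y-z]≈xy-xz)
  open import Algebra.Properties.Group (CommutativeRing.+-group R)
    using (x∙y⁻¹≈ε⇒x≈y; x≈y⇒x∙y⁻¹≈ε; ∙-cancelˡ)

  *-cancelˡ-≉0 : ∀ {x} → ¬ x ≈ 0# → ∀ y z → (x * y) ≈ (x * z) → y ≈ z
  *-cancelˡ-≉0 {x} x≉0 y z xy≈xz
    with D.noZeroDivisors x (y + (- z)) (D.trans (x[y-z]≈xy-xz x y z) (x≈y⇒x∙y⁻¹≈ε xy≈xz))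
  ... | inj₁ x≈0   = contradiction x≈0 x≉0
  ... | inj₂ y-z≈0 = x∙y⁻¹≈ε⇒x≈y y z y-z≈0

  -- The values are `a`, `a + x` and `a + x c`, left in the unsimplified form that `eval` produces.
  -- Comparing them in turn gives `a ≈ a′`, then `x ≈ x′`, then equal products, from which `x`
  -- cancels.
  coefficient-unique : ∀ {a a′ x x′ c c′ p q r} → ¬ x ≈ 0# →
    p ≈ (a + 0#) → q ≈ (a + (x * (1# + 0#))) → r ≈ (a + (x * (c + 0#))) →
    p ≈ (a′ + 0#) → q ≈ (a′ + (x′ * (1# + 0#))) → r ≈ (a′ + (x′ * (c′ + 0#))) →
    c ≈ c′
  coefficient-unique {a} {a′} {x} {x′} {c} {c′} {p} {q} {r} x≉0 p≈ q≈ r≈ p≈′ q≈′ r≈′ =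
    *-cancelˡ-≉0 x≉0 c c′ (∙-cancelˡ a _ _ (begin
      a + (x * c)            ≈⟨ D.+-cong D.refl (D.*-cong D.refl (D.+-identityʳ c)) ⟨
      a + (x * (c + 0#))     ≈⟨ r≈ ⟨
      r                      ≈⟨ r≈′ ⟩
      a′ + (x′ * (c′ + 0#))  ≈⟨ D.+-cong (D.sym a≈a′) (D.*-cong (D.sym x≈x′) (D.+-identityʳ c′)) ⟩
      a + (x * c′)           ∎))
    where
    a≈a′ : a ≈ a′
    a≈a′ = begin
      a        ≈⟨ D.+-identityʳ a ⟨
      a + 0#   ≈⟨ p≈ ⟨
      p        ≈⟨ p≈′ ⟩
      a′ + 0#  ≈⟨ D.+-identityʳ a′ ⟩
      a′       ∎

    x*[1+0]≈x : ∀ x → (x * (1# + 0#)) ≈ x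
    x*[1+0]≈x x = D.trans (D.*-cong D.refl (D.+-identityʳ 1#)) (D.*-identityʳ x)

    x≈x′ : x ≈ x′
    x≈x′ = ∙-cancelˡ a x x′ (begin
      a + x                   ≈⟨ D.+-cong D.refl (x*[1+0]≈x x) ⟨
      a + (x * (1# + 0#))     ≈⟨ q≈ ⟨
      q                       ≈⟨ q≈′ ⟩
      a′ + (x′ * (1# + 0#))   ≈⟨ D.+-cong (D.sym a≈a′) (x*[1+0]≈x x′) ⟩
      a + x′                  ∎)

-- The semigroup inside its difference group.

module CancellativeDifference {ℓ} (S : CommutativeSemigroup ℓ ℓ) where
  open CommutativeSemigroup S renaming (_∙_ to _+_)
  open Difference S
  open SetoidReasoning setoid

  ι-cong : ∀ {s t} → s ≈ t → ι s ≈ᵈ ι t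
  ι-cong s≈t = ∙-cong (∙-cong s≈t s≈t) (sym s≈t)

  module _ (cancel : Cancellative _≈_ _+_) where

    ι-injective : ∀ {s t} → ι s ≈ᵈ ι t → s ≈ t
    ι-injective {s} {t} eq = proj₂ cancel (s + t) s t (begin
      s + (s + t)  ≈⟨ assoc s s t ⟨
      (s + s) + t  ≈⟨ eq ⟩
      (t + t) + s  ≈⟨ assoc t t s ⟩
      t + (t + s)  ≈⟨ ∙-cong refl (comm t s) ⟩
      t + (s + t)  ∎)

    -- Cancelling `w` from `w + e + s ≈ w + s` makes `e` neutral for every `s`.
    absorbed⇒identity : ∀ {e w} → w + e ≈ w → Identity _≈_ e _+_
    absorbed⇒identity {e} {w} we≈w = e+s≈s , λ s → trans (comm s e) (e+s≈s s)
      where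
      e+s≈s : ∀ s → e + s ≈ s
      e+s≈s s = proj₁ cancel w (e + s) s (trans (sym (assoc w e s)) (∙-cong we≈w refl))

    module _ (noIdentity : ¬ (∃[ e ] Identity _≈_ e _+_)) {_*_ : Op₂ Diff} {0# 1# : Diff}
             (isID : IsIntegralDomain _≈ᵈ_ _+ᵈ_ _*_ -ᵈ_ 0# 1#) where
      private module D = IsIntegralDomain isID
      open Polynomial _*_ 0#

      ι≉0 : ∀ x → ¬ ι x ≈ᵈ 0#
      -- Unfolded, `2ιx≈ιx` says `w + x ≈ w` for `w = (x + x) + (x + x)`, so `x` would be an
      -- identity.
      ι≉0 x ιx≈0 = noIdentity (x , absorbed⇒identity 2ιx≈ιx)
        where
        2ιx≈ιx : ι x +ᵈ ι x ≈ᵈ ι x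
        2ιx≈ιx = D.trans {ι x +ᵈ ι x} {0# +ᵈ ι x} {ι x}
          (D.+-cong {ι x} {0#} {ι x} {ι x} ιx≈0 (D.refl {ι x})) (D.+-identityˡ (ι x))

      Witness : Carrier → Carrier → Carrier → Carrier → Set ℓ
      Witness s p q r = ∃[ a ] ∃[ x ]
        (ι p ≈ᵈ ι a +ᵈ eval [] (ι x)) ×
        (ι q ≈ᵈ ι a +ᵈ eval (1# ∷ []) (ι x)) ×
        (ι r ≈ᵈ ι a +ᵈ eval (ι s ∷ []) (ι x))

      private
        ι-≈-trans : ∀ {p p′ d} → p ≈ p′ → ι p ≈ᵈ d → ι p′ ≈ᵈ d
        ι-≈-trans {p} {p′} {d} p≈p′ = D.trans {ι p′} {ι p} {d} (ι-cong (sym p≈p′))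

      Witness-cong : ∀ {s p p′ q q′ r r′} → p ≈ p′ → q ≈ q′ → r ≈ r′ →
                     Witness s p q r → Witness s p′ q′ r′
      Witness-cong p≈ q≈ r≈ (a , x , ιp≈ , ιq≈ , ιr≈) =
        a , x , ι-≈-trans {d = _ , _} p≈ ιp≈
              , ι-≈-trans {d = _ , _} q≈ ιq≈
              , ι-≈-trans {d = _ , _} r≈ ιr≈

      Witness-injective : ∀ {s s′ p q r} → Witness s p q r → Witness s′ p q r → s ≈ s′
      Witness-injective {s} {s′} {p} {q} {r} (a , x , p≈ , q≈ , r≈) (a′ , x′ , p≈′ , q≈′ , r≈′) =
        ι-injective (coefficient-unique {ι a} {ι a′} {ι x} {ι x′} {ι s} {ι s′} {ι p} {ι q} {ι r}
          (ι≉0 x) p≈ q≈ r≈ p≈′ q≈′ r≈′)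
        where open IntegralDomain isID

      PPRich⇒Witness : ∀ {A} → PPRich A → ∀ s →
                       ∃[ p ] A p × ∃[ q ] A q × ∃[ r ] A r × Witness s p q r
      PPRich⇒Witness rich s with rich (polynomial [] ∷ polynomial (1# ∷ []) ∷ polynomial (ι s ∷ []) ∷ [])
        where
        polynomial : List Diff → ℙ
        polynomial cs = eval cs , cs , λ z → D.refl {eval cs z}
      ... | a , x , (p , Ap , p≈) ∷ (q , Aq , q≈) ∷ (r , Ar , r≈) ∷ [] =
        p , Ap , q , Aq , r , Ar , a , x , p≈ , q≈ , r≈

-- Transport of the rich set to `κ` and its cofinality there.

theorem5p6 : ∀ {ℓ} → ExcludedMiddle ℓ →
  (S : CommutativeSemigroup ℓ ℓ) →
  let open CommutativeSemigroup S renaming (_∙_ to _+_)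
      open Difference S in
  Cancellative _≈_ _+_ →
  ¬ (∃[ e ] Identity _≈_ e _+_) →
  (_*_ : Op₂ Diff) (0# 1# : Diff)
  (isID : IsIntegralDomain _≈ᵈ_ _+ᵈ_ _*_ -ᵈ_ 0# 1#) →
  (κ : InfiniteRegularCardinal ℓ) →
  let open InfiniteRegularCardinal κ using () renaming (asSet to ∣κ∣)
      open Polynomial _*_ 0# in
  setoid ≅ ∣κ∣ →
  IsVeryWeaklyCancellative (nonzeroSemigroup isID) →
  (A : Pred Carrier ℓ) → A Respects _≈_ → PPRich A →
  setoid ↾ A ≅ ∣κ∣
theorem5p6 em S cancel noIdentity _*_ 0# 1# isID κ S≅κ _ A A-resp rich =
  Composition.bijection A≅X (Cofinal⇒≅ X-resp X-cofinal)
  where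
  open CommutativeSemigroup S using (_≈_; sym; trans; setoid)
  open InfiniteRegularCardinal κ using (Cofinal; asSet; Carrier) renaming (_≈_ to _≈κ_)
  open RegularCardinal em κ
  open CancellativeDifference S
  open Inverse (Bijection⇒Inverse S≅κ)
    using (to; from; to-cong; from-cong; strictlyInverseˡ; strictlyInverseʳ)

  T : Carrier → Carrier → Carrier → Carrier → Set _
  T α β γ δ = Witness cancel noIdentity isID (from α) (from β) (from γ) (from δ)

  X : Pred Carrier _
  X α = A (from α)

  X-resp : X Respects _≈κ_
  X-resp α≈β = A-resp (from-cong α≈β)

  A≅X : setoid ↾ A ≅ asSet ↾ X
  A≅X = record
    { to        = λ (s , As) → to s , A-resp (sym (strictlyInverseʳ s)) As
    ; cong      = Bijection.cong S≅κ
    ; bijective = Bijection.injective S≅κ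
                , λ (α , Xα) → (from α , Xα) , proj₂ (Bijection.surjective S≅κ α)
    }

  pointwise : ∀ α → ∃[ β ] X β × ∃[ γ ] X γ × ∃[ δ ] X δ × T α β γ δ
  pointwise α =
    let p , Ap , q , Aq , r , Ar , w = PPRich⇒Witness cancel noIdentity isID rich (from α)
    in to p , to-X Ap , to q , to-X Aq , to r , to-X Ar ,
       Witness-cong cancel noIdentity isID (≈from∘to p) (≈from∘to q) (≈from∘to r) w
    where
    ≈from∘to : ∀ s → s ≈ from (to s)
    ≈from∘to s = sym (strictlyInverseʳ s)

    to-X : ∀ {s} → A s → X (to s)
    to-X = A-resp (≈from∘to _)

  T-resp : ∀ {α β β′ γ γ′ δ δ′} → β ≈κ β′ → γ ≈κ γ′ → δ ≈κ δ′ → T α β γ δ → T α β′ γ′ δ′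
  T-resp β≈ γ≈ δ≈ = Witness-cong cancel noIdentity isID (from-cong β≈) (from-cong γ≈) (from-cong δ≈)

  T-injective : ∀ {α α′ β γ δ} → T α β γ δ → T α′ β γ δ → α ≈κ α′
  T-injective {α} {α′} t t′ =
    κ.trans (κ.sym (strictlyInverseˡ α))
      (κ.trans (to-cong (Witness-injective cancel noIdentity isID t t′)) (strictlyInverseˡ α′))
    where module κ = Setoid asSet

  X-cofinal : Cofinal X
  X-cofinal = decidable-stable em λ ¬cof →
    -- The three rounds fix `β`, `γ` and `δ` in turn. Each cofinal set retains the existential over
    -- the coordinates still free, so `proj₂` supplies totality for the next round.
    let β , Xβ , C₁ = pigeonhole ¬cof {λ _ → ⊤} (λ α → α , tt , inj₂ κ.refl)
          (λ α β → ∃[ γ ] X γ × ∃[ δ ] X δ × T α β γ δ)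
          (λ β≈ (γ , Xγ , δ , Xδ , t) → γ , Xγ , δ , Xδ , T-resp β≈ κ.refl κ.refl t)
          (λ {α} _ → pointwise α)
        γ , Xγ , C₂ = pigeonhole ¬cof C₁
          (λ α γ → ∃[ δ ] X δ × T α β γ δ)
          (λ γ≈ (δ , Xδ , t) → δ , Xδ , T-resp κ.refl γ≈ κ.refl t)
          proj₂
        δ , Xδ , C₃ = pigeonhole ¬cof C₂
          (λ α δ → T α β γ δ)
          (λ δ≈ → T-resp κ.refl κ.refl δ≈)
          proj₂
        -- A cofinal set has two distinct elements, and here they share the triple `β`, `γ`, `δ`.
        _ , _ , (_ , t) , (_ , t′) , α≉α′ = Cofinal-distinct _ C₃
    in α≉α′ (T-injective t t′)
    where module κ = Setoid asSet
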